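{- Let $\mathbf{s}$ be a sequence of positive integers and $n\geq1$. The $h^*$-vector of $\mathcal{R}_n^{(\mathbf{s})}$ is symmetric if and only if $\mathcal{C}_n^{(\mathbf{s})}$ is Gorenstein.
   Context: $\mathcal{C}_n^{(\mathbf{s})}=\{\lambda\in\mathbb{R}^n: 0\leq\lambda_1/s_1\leq\cdots\leq\lambda_n/s_n\}$ and $\mathcal{L}_n^{(\mathbf{s})}=\mathcal{C}_n^{(\mathbf{s})}\cap\mathbb{Z}^n$. The rational lecture hall polytope is $\mathcal{R}_n^{(\mathbf{s})}=\{\lambda\in\mathcal{C}_n^{(\mathbf{s})}:\lambda_n\leq1\}$. For integers $t\geq0$ let $i(\mathcal{R}_n^{(\mathbf{s})},t)=|\{\lambda\in\mathcal{L}_n^{(\mathbf{s})}:\lambda_n\leq t\}|$, and let $\mathcal{E}_n^{(\mathbf{s})}(x)=\sum_{t\geq0} i(\mathcal{R}_n^{(\mathbf{s})},t)x^t$. It is known that $Q_n^{(\mathbf{s})}(x):=(1-x^{s_n})^{n+1}\mathcal{E}_n^{(\mathbf{s})}(x)$ is a polynomial (with positive integer coefficients); its coefficient sequence is the $h^*$-vector of $\mathcal{R}_n^{(\mathbf{s})}$, and the $h^*$-vector is symmetric if this coefficient sequence reads the same from left to right as from right to left. A pointed rational cone $\mathcal{C}\subset\mathbb{R}^n$ is Gorenstein if there is an integer point $\mathbf{c}$ in the interior $\mathcal{C}^\circ$ such that $\mathcal{C}^\circ\cap\mathbb{Z}^n=\mathbf{c}+(\mathcal{C}\cap\mathbb{Z}^n)$.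 -}

module Defs where

open import Data.Nat as ℕ using (ℕ; zero; suc; _∸_; _≤ᵇ_)
open import Data.Nat.Combinatorics using (_C_)
open import Data.Integer using (ℤ; +_; -_; _*_; _+_; _≤_; _<_)
open import Data.Fin using (Fin; toℕ)
open import Data.Vec using (Vec; lookup; zipWith)
open import Data.List using (List; length; upTo; map; foldr)
open import Data.List.Relation.Unary.Unique.Propositional using (Unique)
open import Data.List.Membership.Propositional using (_∈_)
open import Data.Product using (Σ; ∃; ∃-syntax; _×_)
open import Data.Bool using (if_then_else_)
open import Function.Bundles using (_⇔_)
open import Relation.Binary.PropositionalEquality using (_≡_; _≢_)

-- Conventions: the sequence s = (s_1, s_2, ...) is a function s : ℕ → ℕ with
-- s k = s_{k+1}.  A point λ ∈ ℤ^n is a vector v : Vec ℤ n with lookup v i = λ_{i+1}.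

-- λ ∈ 𝓛_n^(s) = C_n^(s) ∩ ℤ^n :  0 ≤ λ_1/s_1 ≤ ... ≤ λ_n/s_n,
-- with λ_i/s_i ≤ λ_{i+1}/s_{i+1} written as λ_i s_{i+1} ≤ λ_{i+1} s_i (s positive).
InCone : (s : ℕ → ℕ) (n : ℕ) → Vec ℤ n → Set
InCone s n v =
  (∀ (i : Fin n) → toℕ i ≡ 0 → + 0 ≤ lookup v i)
  × (∀ (i j : Fin n) → toℕ j ≡ suc (toℕ i) →
       lookup v i * + s (toℕ j) ≤ lookup v j * + s (toℕ i))

InInterior : (s : ℕ → ℕ) (n : ℕ) → Vec ℤ n → Set
InInterior s n v =
  (∀ (i : Fin n) → toℕ i ≡ 0 → + 0 < lookup v i)
  × (∀ (i j : Fin n) → toℕ j ≡ suc (toℕ i) →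
       lookup v i * + s (toℕ j) < lookup v j * + s (toℕ i))

Gorenstein : (s : ℕ → ℕ) (n : ℕ) → Set
Gorenstein s n =
  Σ (Vec ℤ n) λ c → InInterior s n c ×
    (∀ (v : Vec ℤ n) → InInterior s n v ⇔ (Σ (Vec ℤ n) λ μ → InCone s n μ × v ≡ zipWith _+_ c μ))

InDilate : (s : ℕ → ℕ) (n : ℕ) (t : ℕ) → Vec ℤ n → Set
InDilate s n t v = InCone s n v × (∀ (i : Fin n) → toℕ i ≡ n ∸ 1 → lookup v i ≤ + t)

IsCardinality : {n : ℕ} → (Vec ℤ n → Set) → ℕ → Set
IsCardinality {n} P N =
  Σ (List (Vec ℤ n)) λ xs → Unique xs × (∀ v → (v ∈ xs) ⇔ P v) × length xs ≡ N

negOnePow : ℕ → ℤ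
negOnePow zero = + 1
negOnePow (suc j) = - negOnePow j

sumℤ : List ℤ → ℤ
sumℤ = foldr _+_ (+ 0)

-- Coefficient of x^k in Q_n^(s)(x) = (1 - x^{s_n})^{n+1} Σ_t i(t) x^t, where
-- i is the Ehrhart-type counting function and s_n = s (n ∸ 1):
--   Σ_{j=0}^{n+1} (-1)^j C(n+1,j) i(k - j s_n)   (terms with j s_n > k omitted).
hstarCoeff : (s : ℕ → ℕ) (n : ℕ) (i : ℕ → ℕ) → ℕ → ℤ
hstarCoeff s n i k = sumℤ (map term (upTo (suc (suc n))))
  where
  sn = s (n ∸ 1)
  term : ℕ → ℤ
  term j = if (j ℕ.* sn) ≤ᵇ k
             then negOnePow j * + ((suc n C j) ℕ.* i (k ∸ j ℕ.* sn))
             else + 0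

SymmetricCoeffs : (ℕ → ℤ) → Set
SymmetricCoeffs q =
  ∃[ d ] (q d ≢ + 0)
       × (∀ k → d ℕ.< k → q k ≡ + 0)
       × (∀ k → k ℕ.≤ d → q k ≡ q (d ∸ k))

{-# OPTIONS --safe #-}
module Submission where

-- Adjoining the level t as a last coordinate makes {(λ, t) : λ ∈ C_n, λ_n ≤ t} a simplicial cone with
-- n + 1 ray generators, all at level s_n. Hence (1 - x^{s_n})^{n+1} times the level series I(t) of its
-- points counts the points of a half-open parallelepiped: this is Q. The same product for the series
-- I°(t) of interior points counts the opposite half-open parallelepiped, and the point reflection
-- exchanging the two gives Q°(t) = Q(N - t) with N = (n + 1) s_n. So Q is symmetric of degree d iff
-- Q°(t) = Q(t - m) with m = N - d, iff I°(t) = I(t - m) for all t. If c + C_n is the set of interior lattice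
-- points, this holds with m = c_n + 1. Conversely it yields an interior point c at level m, and then
-- c + (C_n at level ≤ t - m) lies in the interior at level t and has the same finite cardinality, so
-- the two sets agree.

open import Defs
open import Data.Nat using (ℕ; _<_; _≤_)
open import Function.Bundles using (_⇔_)

open import Data.Nat as ℕ using (zero; suc; s≤s; z≤n; _⊓_; _∸_; _≤ᵇ_)
import Data.Nat.Properties as ℕₚ
open import Data.Nat.Combinatorics using (_C_; nCk+nC[k+1]≡[n+1]C[k+1])
open import Data.Integer as ℤ using (ℤ; +_; -[1+_]; _+_; _*_; -_; _-_)
import Data.Integer.Properties as ℤₚ
open import Data.Integer.Tactic.RingSolver using (solve-∀)
open import Data.Bool using (true; false; if_then_else_; T)
open import Data.Fin as Fin using (Fin; toℕ; fromℕ<)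
import Data.Fin.Properties as Finₚ
open import Data.List using (List; []; _∷_; _++_; length; map; filter; applyUpTo)
import Data.List.Properties as Listₚ
open import Data.List.Membership.Propositional using (_∈_)
open import Data.List.Membership.Propositional.Properties
  using (∈-map⁺; ∈-map⁻; ∈-filter⁺; ∈-filter⁻; ∈-∃++; ∈-++⁺ˡ; ∈-++⁺ʳ; ∈-++⁻)
import Data.List.Membership.DecPropositional as DecMembership
open import Data.List.Relation.Unary.All as All using (All)
open import Data.List.Relation.Unary.AllPairs using ([]; _∷_)
open import Data.List.Relation.Unary.Any using (here; there)
open import Data.List.Relation.Unary.Unique.Propositional using (Unique)
import Data.List.Relation.Unary.Unique.Propositional.Properties as Uniqueₚ
open import Data.Product using (Σ; ∃; ∃-syntax; _×_; _,_; proj₁; proj₂)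
open import Data.Sum using (inj₁; inj₂)
open import Data.Unit using (tt)
open import Data.Vec using (Vec; []; _∷_; lookup; zipWith)
import Data.Vec.Properties as Vecₚ
open import Function using (_∘_; id)
open import Function.Bundles using (mk⇔; module Equivalence)
open import Relation.Binary.Definitions using (DecidableEquality; tri<; tri≈; tri>)
open import Relation.Binary.PropositionalEquality
open import Relation.Nullary using (¬_; yes; no; does; contradiction)
open import Relation.Nullary.Decidable using (¬?; map′; _×-dec_; _→-dec_)
open import Relation.Unary using (Decidable)

open Equivalence using (to; from)

-- Reduces a rearrangement of a linear inequality to a ring identity between differences.
≤-transport : ∀ {a b c d} → b - a ≡ d - c → a ℤ.≤ b → c ℤ.≤ d
≤-transport eq a≤b = ℤₚ.0≤i-j⇒j≤i (subst (+ 0 ℤ.≤_) eq (ℤₚ.i≤j⇒0≤j-i a≤b))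

+-cancelʳ-minus : ∀ a b → (a + b) - b ≡ a
+-cancelʳ-minus = solve-∀

minus-cancelʳ-+ : ∀ a b → (a - b) + b ≡ a
minus-cancelʳ-+ = solve-∀

minus-involutive : ∀ a b → a - (a - b) ≡ b
minus-involutive = solve-∀

i<1+∣i∣ : ∀ i → i ℤ.< + suc ℤ.∣ i ∣
i<1+∣i∣ (+ _) = ℤ.+<+ ℕₚ.≤-refl
i<1+∣i∣ -[1+ _ ] = ℤ.-<+

-- Cardinalities of predicates

-- The count is an integer so that counts can be subtracted and fed to `Δ`.
HasCard : {A : Set} → (A → Set) → ℤ → Set
HasCard {A} P z =
  Σ (List A) λ xs → Unique xs × (∀ v → (v ∈ xs) ⇔ P v) × + length xs ≡ z

-- Cut the head x out of `ys`: the tail of `xs` fits into what remains, because x does not recur in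
-- it.
⊆⇒length≤ : {A : Set} {xs ys : List A} → Unique xs → (∀ {x} → x ∈ xs → x ∈ ys) →
            length xs ≤ length ys
⊆⇒length≤ {xs = []} _ _ = z≤n
⊆⇒length≤ {xs = x ∷ xs} (x≢ ∷ unique) xs⊆ys with ∈-∃++ (xs⊆ys (here refl))
... | ys₁ , ys₂ , refl = ℕₚ.≤-trans (s≤s (⊆⇒length≤ unique xs⊆ys∖x)) (ℕₚ.≤-reflexive (sym length-pivot))
  where
  length-pivot : length (ys₁ ++ x ∷ ys₂) ≡ suc (length (ys₁ ++ ys₂))
  length-pivot = trans (Listₚ.length-++ ys₁)
    (trans (ℕₚ.+-suc (length ys₁) (length ys₂)) (cong suc (sym (Listₚ.length-++ ys₁))))
  xs⊆ys∖x : ∀ {z} → z ∈ xs → z ∈ ys₁ ++ ys₂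
  xs⊆ys∖x z∈xs with ∈-++⁻ ys₁ (xs⊆ys (there z∈xs))
  ... | inj₁ z∈ys₁ = ∈-++⁺ˡ z∈ys₁
  ... | inj₂ (here z≡x) = contradiction (sym z≡x) (All.lookup x≢ z∈xs)
  ... | inj₂ (there z∈ys₂) = ∈-++⁺ʳ ys₁ z∈ys₂

length-filter-¬ : {A : Set} {Q : A → Set} (Q? : Decidable Q) (xs : List A) →
                  length xs ≡ length (filter Q? xs) ℕ.+ length (filter (¬? ∘ Q?) xs)
length-filter-¬ Q? [] = refl
length-filter-¬ Q? (x ∷ xs) with does (Q? x)
... | true = cong suc (length-filter-¬ Q? xs)
... | false = trans (cong suc (length-filter-¬ Q? xs)) (sym (ℕₚ.+-suc _ _))

module _ {A : Set} {P : A → Set} where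

  card-≢0 : ∀ {z} → HasCard P z → ∃ P → z ≢ + 0
  card-≢0 ([] , _ , mem , refl) (v , Pv) = contradiction (from (mem v) Pv) λ ()
  card-≢0 (_ ∷ _ , _ , _ , refl) _ = λ ()

  card-inhabited : ∀ {z} → HasCard P z → z ≢ + 0 → ∃ P
  card-inhabited ([] , _ , _ , eq) z≢0 = contradiction (sym eq) z≢0
  card-inhabited (x ∷ _ , _ , mem , _) _ = x , to (mem x) (here refl)

  card-empty : (∀ v → ¬ P v) → HasCard P (+ 0)
  card-empty ¬P = [] , [] , (λ v → mk⇔ (λ ()) λ Pv → contradiction Pv (¬P v)) , refl

  card-filter : ∀ {z} {Q : A → Set} (Q? : Decidable Q) (cardP : HasCard P z) →
                HasCard (λ v → P v × Q v) (+ length (filter Q? (proj₁ cardP)))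
  card-filter Q? (xs , unique , mem , _) =
    filter Q? xs , Uniqueₚ.filter⁺ Q? unique ,
    (λ v → mk⇔ (λ v∈ → let (v∈xs , Qv) = ∈-filter⁻ Q? {xs = xs} v∈ in to (mem v) v∈xs , Qv)
               (λ (Pv , Qv) → ∈-filter⁺ Q? (from (mem v) Pv) Qv)) ,
    refl

  card-map : ∀ {B : Set} {Q : B → Set} {z} (f : A → B) → (∀ {x y} → f x ≡ f y → x ≡ y) →
             HasCard P z → (∀ v → (∃[ u ] P u × v ≡ f u) ⇔ Q v) → HasCard Q z
  card-map f inj (xs , unique , mem , eq) Q⇔ =
    map f xs , Uniqueₚ.map⁺ inj unique ,
    (λ v → mk⇔ (λ v∈ → let (u , u∈ , v≡) = ∈-map⁻ f v∈ in to (Q⇔ v) (u , to (mem u) u∈ , v≡))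
               (λ Qv → let (u , Pu , v≡) = from (Q⇔ v) Qv in
                       subst (_∈ map f xs) (sym v≡) (∈-map⁺ f (from (mem u) Pu)))) ,
    trans (cong +_ (Listₚ.length-map f xs)) eq

  card-resp : ∀ {Q : A → Set} {z} → (∀ v → P v ⇔ Q v) → HasCard P z → HasCard Q z
  card-resp P⇔Q (xs , unique , mem , eq) =
    xs , unique ,
    (λ v → mk⇔ (λ v∈ → to (P⇔Q v) (to (mem v) v∈)) (λ Qv → from (mem v) (from (P⇔Q v) Qv))) ,
    eq

  card-mono : ∀ {Q : A → Set} {a b} → (∀ v → P v → Q v) → HasCard P a → HasCard Q b → a ℤ.≤ b
  card-mono P⊆Q (xs , unique , mem , refl) (ys , _ , mem′ , refl) =
    ℤ.+≤+ (⊆⇒length≤ unique λ {x} x∈ → from (mem′ x) (P⊆Q x (to (mem x) x∈)))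

  -- If `v` were missing from `xs`, then `v ∷ xs` would be a duplicate-free list inside `ys` and
  -- longer than it.
  card-⊆-equal : DecidableEquality A → ∀ {Q : A → Set} {z} → (∀ v → P v → Q v) →
                 HasCard P z → HasCard Q z → ∀ v → Q v → P v
  card-⊆-equal _≟_ P⊆Q (xs , unique , mem , eq) (ys , _ , mem′ , eq′) v Qv
    with DecMembership._∈?_ _≟_ v xs
  ... | yes v∈xs = to (mem v) v∈xs
  ... | no v∉xs = contradiction
    (subst (suc (length xs) ≤_) (ℤₚ.+-injective (trans eq′ (sym eq)))
      (⊆⇒length≤ (All.tabulate (λ x∈xs v≡x → v∉xs (subst (_∈ xs) (sym v≡x) x∈xs)) ∷ unique) v∷xs⊆ys))
    ℕₚ.1+n≰n
    where
    v∷xs⊆ys : ∀ {x} → x ∈ v ∷ xs → x ∈ ys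
    v∷xs⊆ys (here refl) = from (mem′ v) Qv
    v∷xs⊆ys {x} (there x∈) = from (mem′ x) (P⊆Q x (to (mem x) x∈))

card-unique : {A : Set} {P : A → Set} {a b : ℤ} → HasCard P a → HasCard P b → a ≡ b
card-unique a b = ℤₚ.≤-antisym (card-mono (λ _ → id) a b) (card-mono (λ _ → id) b a)

-- Filtering by `Q` and by its negation splits the list for `P`, and uniqueness of cardinality
-- identifies the second length with `b`. The difference is the one that occurs in `Δ`.
card-split : {A : Set} {P Q : A → Set} {a b : ℤ} (Q? : Decidable Q) → HasCard P a →
             HasCard (λ v → P v × ¬ Q v) b → HasCard (λ v → P v × Q v) (a - b)
card-split {b = b} Q? cardP@(xs , _ , _ , refl) cardP∖Q =
  subst (HasCard _) count (card-filter Q? cardP)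
  where
  open ≡-Reasoning
  #yes = + length (filter Q? xs)
  count : #yes ≡ + length xs - b
  count = begin
    #yes                                               ≡⟨ +-cancelʳ-minus #yes b ⟨
    #yes + b - b                                       ≡⟨ cong (λ c → #yes + c - b) (card-unique cardP∖Q (card-filter (¬? ∘ Q?) cardP)) ⟩
    #yes + + length (filter (¬? ∘ Q?) xs) - b          ≡⟨ cong (λ l → + l - b) (length-filter-¬ Q? xs) ⟨
    + length xs - b                                    ∎

-- Backward differences

-- On generating series this is multiplication by 1 - x^s. Functions live on all of ℤ, so no
-- truncation occurs.
Δ : ℤ → (ℤ → ℤ) → ℤ → ℤ
Δ s f t = f t - f (t - s)

Δ^ : ℤ → ℕ → (ℤ → ℤ) → ℤ → ℤ
Δ^ s zero f = f
Δ^ s (suc m) f = Δ s (Δ^ s m f)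

Δ^-translate : ∀ s m {f g : ℤ → ℤ} c → (∀ t → f t ≡ g (t - c)) →
               ∀ t → Δ^ s m f t ≡ Δ^ s m g (t - c)
Δ^-translate s zero c f≗g t = f≗g t
Δ^-translate s (suc m) {g = g} c f≗g t =
  cong₂ _-_ (Δ^-translate s m c f≗g t)
    (trans (Δ^-translate s m c f≗g (t - s)) (cong (Δ^ s m g) (swap t s c)))
  where
  swap : ∀ t s c → t - s - c ≡ t - c - s
  swap = solve-∀

module _ (s : ℤ) (0<s : + 0 ℤ.< s) where

  t-s≤ : ∀ {t b} → t ℤ.≤ b → t - s ℤ.≤ b
  t-s≤ {t} t≤b = ℤₚ.≤-trans (ℤₚ.i-j≤i t s {{ℤ.nonNegative (ℤₚ.<⇒≤ 0<s)}}) t≤b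

  Δ^-vanish : ∀ m {f : ℤ → ℤ} b → (∀ {t} → t ℤ.≤ b → f t ≡ + 0) →
              ∀ {t} → t ℤ.≤ b → Δ^ s m f t ≡ + 0
  Δ^-vanish zero b f≡0 = f≡0
  Δ^-vanish (suc m) b f≡0 t≤b =
    cong₂ _-_ (Δ^-vanish m b f≡0 t≤b) (Δ^-vanish m b f≡0 (t-s≤ t≤b))

  -- Induction on an upper bound for t: f(t) is recovered from its difference and f(t - s), and t -
  -- s obeys a smaller bound because 0 < s. At bound 0 the agreement at negative arguments applies.
  Δ-injective : ∀ {f g : ℤ → ℤ} → (∀ {t} → t ℤ.< + 0 → f t ≡ g t) →
                (∀ t → Δ s f t ≡ Δ s g t) → ∀ t → f t ≡ g t
  Δ-injective {f} {g} f≡g-neg Δf≗Δg t =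
    below ℤ.∣ t ∣ t (i<1+∣i∣ t)
    where
    open ≡-Reasoning
    below : ∀ N t → t ℤ.< + suc N → f t ≡ g t
    step : ∀ N t → t - s ℤ.< + N → f t ≡ g t
    step N t lt = begin
      f t                       ≡⟨ minus-cancelʳ-+ (f t) (f (t - s)) ⟨
      Δ s f t + f (t - s)       ≡⟨ cong₂ _+_ (Δf≗Δg t) (previous N lt) ⟩
      Δ s g t + g (t - s)       ≡⟨ minus-cancelʳ-+ (g t) (g (t - s)) ⟩
      g t                       ∎
      where
      previous : ∀ N → t - s ℤ.< + N → f (t - s) ≡ g (t - s)
      previous zero = f≡g-neg
      previous (suc N) = below N (t - s)
    below N t t<1+N = step N t (ℤₚ.suc[i]≤j⇒i<j (≤-transport (shuffle (+ N) t s)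
      (ℤₚ.+-mono-≤ (ℤₚ.i<j⇒suc[i]≤j t<1+N) (ℤₚ.i<j⇒suc[i]≤j 0<s))))
      where
      shuffle : ∀ N t s → (+ 1 + N + s) - ((+ 1 + t) + + 1) ≡ N - (+ 1 + (t - s))
      shuffle = solve-∀

  Δ^-injective : ∀ m {f g : ℤ → ℤ} → (∀ {t} → t ℤ.≤ -[1+ 0 ] → f t ≡ + 0) →
                 (∀ {t} → t ℤ.≤ -[1+ 0 ] → g t ≡ + 0) →
                 (∀ t → Δ^ s m f t ≡ Δ^ s m g t) → ∀ t → f t ≡ g t
  Δ^-injective zero _ _ f≗g = f≗g
  Δ^-injective (suc m) f≡0 g≡0 Δf≗Δg = Δ^-injective m f≡0 g≡0
    (Δ-injective (λ t<0 → let t≤ = ℤₚ.i<j⇒i≤pred[j] t<0 in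
                    trans (Δ^-vanish m _ f≡0 t≤) (sym (Δ^-vanish m _ g≡0 t≤)))
                 Δf≗Δg)

-- Binomial expansion of differences and the coefficients of Q

Σ< : ℕ → (ℕ → ℤ) → ℤ
Σ< m a = sumℤ (applyUpTo a m)

Σ<-cong : ∀ m {a b : ℕ → ℤ} → (∀ j → a j ≡ b j) → Σ< m a ≡ Σ< m b
Σ<-cong zero a≗b = refl
Σ<-cong (suc m) a≗b = cong₂ _+_ (a≗b 0) (Σ<-cong m (a≗b ∘ suc))

Σ<-minus : ∀ m (a b : ℕ → ℤ) → Σ< m (λ j → a j - b j) ≡ Σ< m a - Σ< m b
Σ<-minus zero a b = refl
Σ<-minus (suc m) a b =
  trans (cong (λ c → a 0 - b 0 + c) (Σ<-minus m (a ∘ suc) (b ∘ suc))) (interchange (a 0) (b 0) _ _)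
  where
  interchange : ∀ a b c d → a - b + (c - d) ≡ a + c - (b + d)
  interchange = solve-∀

Σ<-zero : ∀ m {a : ℕ → ℤ} → (∀ j → a j ≡ + 0) → Σ< m a ≡ + 0
Σ<-zero zero a≗0 = refl
Σ<-zero (suc m) a≗0 = cong₂ _+_ (a≗0 0) (Σ<-zero m (a≗0 ∘ suc))

-- The coefficient of x^j in (1 - x)^m.
signedC : ℕ → ℕ → ℤ
signedC m j = negOnePow j * + (m C j)

signedC-pascal : ∀ m j → signedC (suc m) (suc j) ≡ signedC m (suc j) - signedC m j
signedC-pascal m j = begin
  - negOnePow j * + (suc m C suc j)            ≡⟨ cong (λ c → - negOnePow j * + c) (nCk+nC[k+1]≡[n+1]C[k+1] m j) ⟨
  - negOnePow j * (+ (m C j) + + (m C suc j))  ≡⟨ distrib (negOnePow j) (+ (m C j)) (+ (m C suc j)) ⟩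
  signedC m (suc j) - signedC m j              ∎
  where
  open ≡-Reasoning
  distrib : ∀ p a b → - p * (a + b) ≡ - p * b - p * a
  distrib = solve-∀

Σ<-pascal : ∀ m K (h : ℕ → ℤ) →
  Σ< (suc K) (λ j → signedC (suc m) j * h j)
    ≡ Σ< (suc K) (λ j → signedC m j * h j) - Σ< K (λ j → signedC m j * h (suc j))
Σ<-pascal m K h = begin
  signedC (suc m) 0 * h 0 + Σ< K (λ j → signedC (suc m) (suc j) * h (suc j))
    ≡⟨ cong (λ c → signedC (suc m) 0 * h 0 + c) (trans (Σ<-cong K split) (Σ<-minus K _ _)) ⟩
  signedC m 0 * h 0 + (Σ< K (λ j → signedC m (suc j) * h (suc j)) - Σ< K (λ j → signedC m j * h (suc j)))
    ≡⟨ ℤₚ.+-assoc (signedC m 0 * h 0) _ _ ⟨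
  Σ< (suc K) (λ j → signedC m j * h j) - Σ< K (λ j → signedC m j * h (suc j)) ∎
  where
  open ≡-Reasoning
  split : ∀ j → signedC (suc m) (suc j) * h (suc j)
              ≡ signedC m (suc j) * h (suc j) - signedC m j * h (suc j)
  split j = trans (cong (_* h (suc j)) (signedC-pascal m j)) (distrib (signedC m (suc j)) (signedC m j) (h (suc j)))
    where
    distrib : ∀ a b c → (a - b) * c ≡ a * c - b * c
    distrib = solve-∀

-- Any number K > m of terms is allowed, since the further binomials vanish. The induction needs
-- this slack: `Σ<-pascal` leaves two sums for the same m, one with K + 1 terms and one with K.
Δ^-binomial : ∀ s m {K} → m < K → ∀ f t →
              Δ^ s m f t ≡ Σ< K (λ j → signedC m j * f (t - + j * s))
Δ^-binomial s zero {suc K} _ f t = sym (begin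
  signedC 0 0 * f (t - + 0 * s) + Σ< K (λ j → signedC 0 (suc j) * f (t - + suc j * s))
    ≡⟨ cong₂ _+_ (trans (ℤₚ.*-identityˡ _) (cong f (unshift t s)))
                 (Σ<-zero K λ j → trans (cong (_* f (t - + suc j * s)) (ℤₚ.*-zeroʳ (- negOnePow j))) (ℤₚ.*-zeroˡ (f (t - + suc j * s)))) ⟩
  f t + + 0
    ≡⟨ ℤₚ.+-identityʳ (f t) ⟩
  f t ∎)
  where
  open ≡-Reasoning
  unshift : ∀ t s → t - + 0 * s ≡ t
  unshift = solve-∀
Δ^-binomial s (suc m) {suc K} (s≤s m<K) f t = sym (begin
  Σ< (suc K) (λ j → signedC (suc m) j * f (t - + j * s))
    ≡⟨ Σ<-pascal m K (λ j → f (t - + j * s)) ⟩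
  Σ< (suc K) (λ j → signedC m j * f (t - + j * s)) - Σ< K (λ j → signedC m j * f (t - + suc j * s))
    ≡⟨ cong₂ _-_ (sym (Δ^-binomial s m (ℕₚ.m≤n⇒m≤1+n m<K) f t))
                 (trans (Σ<-cong K λ j → cong (λ u → signedC m j * f u) (shift t (+ j) s))
                        (sym (Δ^-binomial s m m<K f (t - s)))) ⟩
  Δ^ s (suc m) f t ∎)
  where
  open ≡-Reasoning
  shift : ∀ t j s → t - (+ 1 + j) * s ≡ t - s - j * s
  shift = solve-∀

atℕ : (ℕ → ℕ) → ℤ → ℤ
atℕ i (+ t) = + i t
atℕ i -[1+ _ ] = + 0

-- The terms omitted by the test in `hstarCoeff` are those with negative argument, where `atℕ i` is
-- zero.
hstarCoeff≡Δ^ : ∀ s n i k → hstarCoeff s n i k ≡ Δ^ (+ s (n ∸ 1)) (suc n) (atℕ i) (+ k)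
hstarCoeff≡Δ^ s n i k =
  trans (cong sumℤ (Listₚ.map-upTo term (suc (suc n))))
    (trans (Σ<-cong (suc (suc n)) term≡) (sym (Δ^-binomial (+ sn) (suc n) (ℕₚ.n<1+n _) (atℕ i) (+ k))))
  where
  sn = s (n ∸ 1)
  argument : ∀ j → + k - + j * + sn ≡ k ℤ.⊖ j ℕ.* sn
  argument j = trans (cong (_-_ (+ k)) (sym (ℤₚ.pos-* j sn))) (ℤₚ.m-n≡m⊖n k (j ℕ.* sn))
  atℕ-negative : ∀ m {t} → k < m → t ≡ k ℤ.⊖ m → atℕ i t ≡ + 0
  atℕ-negative m k<m refl rewrite ℤₚ.⊖-< k<m with m ∸ k | ℕₚ.m<n⇒0<n∸m k<m
  ... | suc _ | _ = refl
  -- Restates the local summand of `hstarCoeff` so that it can be rewritten.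
  term : ℕ → ℤ
  term j = if (j ℕ.* sn) ≤ᵇ k
             then negOnePow j * + ((suc n C j) ℕ.* i (k ∸ j ℕ.* sn))
             else + 0
  term≡ : ∀ j → term j ≡ signedC (suc n) j * atℕ i (+ k - + j * + sn)
  term≡ j with j ℕ.* sn ≤ᵇ k in eq
  ... | true = begin
    negOnePow j * + ((suc n C j) ℕ.* i (k ∸ j ℕ.* sn))
      ≡⟨ cong (negOnePow j *_) (ℤₚ.pos-* (suc n C j) _) ⟩
    negOnePow j * (+ (suc n C j) * + i (k ∸ j ℕ.* sn))
      ≡⟨ ℤₚ.*-assoc (negOnePow j) _ _ ⟨
    signedC (suc n) j * + i (k ∸ j ℕ.* sn)
      ≡⟨ cong (λ u → signedC (suc n) j * atℕ i u)
           (trans (argument j) (ℤₚ.⊖-≥ {k} {j ℕ.* sn} (ℕₚ.≤ᵇ⇒≤ (j ℕ.* sn) k (subst T (sym eq) tt)))) ⟨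
    signedC (suc n) j * atℕ i (+ k - + j * + sn) ∎
    where open ≡-Reasoning
  ... | false = sym (trans
    (cong (signedC (suc n) j *_)
      (atℕ-negative (j ℕ.* sn) (ℕₚ.≰⇒> λ le → subst T eq (ℕₚ.≤⇒≤ᵇ le)) (argument j)))
    (ℤₚ.*-zeroʳ (signedC (suc n) j)))

-- Vectors extended by a last coordinate

after : ∀ {n} → Vec ℤ n → ℤ → ℕ → ℤ
after [] t j = t
after (x ∷ v) t zero = x
after (x ∷ v) t (suc j) = after v t j

after-zipWith : ∀ (_∙_ : ℤ → ℤ → ℤ) {n} (u v : Vec ℤ n) a b j →
                after (zipWith _∙_ u v) (a ∙ b) j ≡ after u a j ∙ after v b j
after-zipWith _∙_ [] [] a b j = refl
after-zipWith _∙_ (x ∷ u) (y ∷ v) a b zero = refl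
after-zipWith _∙_ (x ∷ u) (y ∷ v) a b (suc j) = after-zipWith _∙_ u v a b j

after-lookup : ∀ {n} (v : Vec ℤ n) t (i : Fin n) → after v t (toℕ i) ≡ lookup v i
after-lookup (x ∷ v) t Fin.zero = refl
after-lookup (x ∷ v) t (Fin.suc i) = after-lookup v t i

after-last : ∀ {n} (v : Vec ℤ n) t → after v t n ≡ t
after-last [] t = refl
after-last (x ∷ v) t = after-last v t

restrict : ∀ n → (ℕ → ℤ) → Vec ℤ n
restrict zero f = []
restrict (suc n) f = f 0 ∷ restrict n (f ∘ suc)

after-restrict : ∀ n f {j} → j ≤ n → after (restrict n f) (f n) j ≡ f j
after-restrict zero f z≤n = refl
after-restrict (suc n) f z≤n = refl
after-restrict (suc n) f (s≤s j≤n) = after-restrict n (f ∘ suc) j≤n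

coord : ∀ {n} → Vec ℤ n → ℤ → ℕ → ℤ
coord v t zero = + 0
coord v t (suc j) = after v t j

-- Lets the origin, the ray generators and the apex be given by formulas on ℕ, from which their gaps
-- are computed.
coord-restrict : ∀ n {f} → f 0 ≡ + 0 → ∀ {j} → j ≤ suc n →
                 coord (restrict n (f ∘ suc)) (f (suc n)) j ≡ f j
coord-restrict n f0≡0 {zero} _ = sym f0≡0
coord-restrict n {f} f0≡0 {suc j} (s≤s j≤n) = after-restrict n (f ∘ suc) j≤n

zipWith-cancel : ∀ (_∙_ _∙⁻_ : ℤ → ℤ → ℤ) → (∀ a b → (a ∙ b) ∙⁻ b ≡ a) →
                 ∀ {n} (u v : Vec ℤ n) → zipWith _∙⁻_ (zipWith _∙_ u v) v ≡ u
zipWith-cancel _∙_ _∙⁻_ cancel [] [] = refl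
zipWith-cancel _∙_ _∙⁻_ cancel (x ∷ u) (y ∷ v) = cong₂ _∷_ (cancel x y) (zipWith-cancel _∙_ _∙⁻_ cancel u v)

zipWith-minus-involutive : ∀ {n} (u v : Vec ℤ n) → zipWith _-_ u (zipWith _-_ u v) ≡ v
zipWith-minus-involutive [] [] = refl
zipWith-minus-involutive (x ∷ u) (y ∷ v) =
  cong₂ _∷_ (minus-involutive x y) (zipWith-minus-involutive u v)

leftInverse⇒injective : ∀ {A B : Set} {f : A → B} (g : B → A) → (∀ x → g (f x) ≡ x) →
                        ∀ {x y} → f x ≡ f y → x ≡ y
leftInverse⇒injective g g∘f {x} {y} eq = trans (sym (g∘f x)) (trans (cong g eq) (g∘f y))

zipWith-+-injectiveˡ : ∀ {n} (w : Vec ℤ n) {u v} → zipWith _+_ u w ≡ zipWith _+_ v w → u ≡ v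
zipWith-+-injectiveˡ w = leftInverse⇒injective (λ x → zipWith _-_ x w)
  (λ u → zipWith-cancel _+_ _-_ +-cancelʳ-minus u w)

zipWith-+-injectiveʳ : ∀ {n} (w : Vec ℤ n) {u v} → zipWith _+_ w u ≡ zipWith _+_ w v → u ≡ v
zipWith-+-injectiveʳ w {u} {v} eq = zipWith-+-injectiveˡ w
  (trans (Vecₚ.zipWith-comm ℤₚ.+-comm u w) (trans eq (Vecₚ.zipWith-comm ℤₚ.+-comm w v)))

-- The homogenized cone

-- A point λ of ℤⁿ at level t is completed to the sequence x₀ = 0, x_j = λ_j, x_{n+1} = t, so that
-- λ ∈ C_n and λ_n ≤ t become the n + 1 conditions x_k / σ_k ≤ x_{k+1} / σ_{k+1}.
module Cone (σ : ℕ → ℤ) (0<σ : ∀ k → + 0 ℤ.< σ k) (n : ℕ) where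

  -- The increment x_{k+1}/σ_{k+1} - x_k/σ_k with denominators cleared; an increment of 1
  -- corresponds to `modulus k`.
  gap : (ℕ → ℤ) → ℕ → ℤ
  gap x k = x (suc k) * σ k - x k * σ (suc k)

  modulus : ℕ → ℤ
  modulus k = σ k * σ (suc k)

  gap-cong : ∀ x y k → x k ≡ y k → x (suc k) ≡ y (suc k) → gap x k ≡ gap y k
  gap-cong x y k eq eq′ = cong₂ (λ a b → b * σ k - a * σ (suc k)) eq eq′

  gap-+ : ∀ (u v : Vec ℤ n) a b k →
          gap (coord (zipWith _+_ u v) (a + b)) k ≡ gap (coord u a) k + gap (coord v b) k
  gap-+ u v a b k = trans
    (gap-cong (coord (zipWith _+_ u v) (a + b)) (λ j → coord u a j + coord v b j) k (sums k) (sums (suc k)))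
    (rearrange (coord u a (suc k)) (coord v b (suc k)) (σ k) (coord u a k) (coord v b k) (σ (suc k)))
    where
    sums : ∀ j → coord (zipWith _+_ u v) (a + b) j ≡ coord u a j + coord v b j
    sums zero = refl
    sums (suc j) = after-zipWith _+_ u v a b j
    rearrange : ∀ a b c d e f → (a + b) * c - (d + e) * f ≡ a * c - d * f + (b * c - e * f)
    rearrange = solve-∀

  gap-minus : ∀ (u v : Vec ℤ n) a b k →
              gap (coord (zipWith _-_ u v) (a - b)) k ≡ gap (coord u a) k - gap (coord v b) k
  gap-minus u v a b k = trans
    (gap-cong (coord (zipWith _-_ u v) (a - b)) (λ j → coord u a j - coord v b j) k (differences k) (differences (suc k)))
    (rearrange (coord u a (suc k)) (coord v b (suc k)) (σ k) (coord u a k) (coord v b k) (σ (suc k)))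
    where
    differences : ∀ j → coord (zipWith _-_ u v) (a - b) j ≡ coord u a j - coord v b j
    differences zero = refl
    differences (suc j) = after-zipWith _-_ u v a b j
    rearrange : ∀ a b c d e f → (a - b) * c - (d - e) * f ≡ a * c - d * f - (b * c - e * f)
    rearrange = solve-∀

  -- e = 0 gives the cone and e = 1 its interior; the first j gaps are confined to one period, so that
  -- j = suc n is a fundamental parallelepiped (half-open at opposite ends for e = 0 and e = 1).
  Slab : (e : ℤ) (j : ℕ) (t : ℤ) → Vec ℤ n → Set
  Slab e j t v = ∀ k → k < suc n →
    e ℤ.≤ gap (coord v t) k × (k < j → gap (coord v t) k ℤ.< e + modulus k)

  slab? : ∀ e j t → Decidable (Slab e j t)
  slab? e j t v = map′ (λ S k → S {k}) (λ S {k} → S k) (ℕₚ.allUpTo? (λ k → (e ℤ.≤? gap (coord v t) k)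
    ×-dec ((k ℕ.<? j) →-dec (gap (coord v t) k ℤ.<? e + modulus k))) (suc n))

  slab-+ : ∀ {e e′ t t′ u v} → Slab e 0 t u → Slab e′ 0 t′ v →
           Slab (e + e′) 0 (t + t′) (zipWith _+_ u v)
  slab-+ {t = t} {t′} {u} {v} Su Sv k k≤n =
    subst (_ ℤ.≤_) (sym (gap-+ u v t t′ k)) (ℤₚ.+-mono-≤ (proj₁ (Su _ k≤n)) (proj₁ (Sv _ k≤n))) , λ ()

  slab-weaken : ∀ {e e′ t v} → e′ ℤ.≤ e → Slab e 0 t v → Slab e′ 0 t v
  slab-weaken e′≤e S k k≤n = ℤₚ.≤-trans e′≤e (proj₁ (S _ k≤n)) , λ ()

  -- The ratios x_k/σ_k start at 0 and never decrease.
  coord-nonneg : ∀ {t v} → Slab (+ 0) 0 t v → ∀ k → k ≤ suc n → + 0 ℤ.≤ coord v t k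
  coord-nonneg S zero _ = ℤₚ.≤-refl
  coord-nonneg {t} {v} S (suc k) k<n@(s≤s k≤n) =
    ℤₚ.*-cancelʳ-≤-pos (+ 0) (coord v t (suc k)) (σ k) {{ℤ.positive (0<σ k)}}
      (ℤₚ.≤-trans
        (ℤₚ.*-monoʳ-≤-nonNeg (σ (suc k)) {{ℤ.nonNegative (ℤₚ.<⇒≤ (0<σ (suc k)))}}
          (coord-nonneg {t} {v} S k (ℕₚ.m≤n⇒m≤1+n k≤n)))
        (ℤₚ.0≤i-j⇒j≤i (proj₁ (S _ k<n))))

  slab-level-nonneg : ∀ {t v} → Slab (+ 0) 0 t v → + 0 ℤ.≤ t
  slab-level-nonneg {t} {v} S = subst (+ 0 ℤ.≤_) (after-last v t) (coord-nonneg {t} {v} S (suc n) ℕₚ.≤-refl)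

  -- The last gap is at least 1 and x_n is nonnegative, so t σ_n is at least 1.
  slab-level-pos : ∀ {t v} → Slab (+ 1) 0 t v → + 0 ℤ.< t
  slab-level-pos {t} {v} S = subst (+ 0 ℤ.<_) (after-last v t)
    (ℤₚ.*-cancelʳ-<-nonNeg (σ n) {{0≤σ n}}
      (ℤₚ.suc[i]≤j⇒i<j (ℤₚ.≤-trans (proj₁ (S _ (ℕₚ.n<1+n n)))
        (≤-transport (shuffle (coord v t (suc n) * σ n) (coord v t n * σ (suc n))) (ℤₚ.*-monoʳ-≤-nonNeg (σ (suc n)) {{0≤σ (suc n)}}
          (coord-nonneg {t} {v} (slab-weaken {v = v} (ℤ.+≤+ z≤n) S) n (ℕₚ.n≤1+n n)))))))
    where
    0≤σ : ∀ k → ℤ.NonNegative (σ k)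
    0≤σ k = ℤ.nonNegative (ℤₚ.<⇒≤ (0<σ k))
    shuffle : ∀ a b → b - + 0 ≡ a - (a - b)
    shuffle = solve-∀

  slab-origin : Slab (+ 0) 0 (+ 0) (restrict n λ _ → + 0)
  slab-origin k (s≤s k≤n) = ℤₚ.≤-reflexive (sym gap≡0) , λ ()
    where
    gap≡0 : gap (coord (restrict n λ _ → + 0) (+ 0)) k ≡ + 0
    gap≡0 = cong₂ (λ a b → b * σ k - a * σ (suc k))
      (coord-restrict n {λ _ → + 0} refl (ℕₚ.m≤n⇒m≤1+n k≤n)) (coord-restrict n {λ _ → + 0} refl (s≤s k≤n))

  -- generator k is the k-th ray generator of the cone: it raises the k-th gap by one period and
  -- fixes the others.

  shiftSeq : ℕ → ℕ → ℤ
  shiftSeq k j = if k ℕ.<ᵇ j then σ j else + 0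

  shiftSeq-> : ∀ {k j} → k < j → shiftSeq k j ≡ σ j
  shiftSeq-> {k} {j} k<j with k ℕ.<ᵇ j | ℕₚ.<⇒<ᵇ k<j
  ... | true | _ = refl

  shiftSeq-≤ : ∀ {k j} → j ≤ k → shiftSeq k j ≡ + 0
  shiftSeq-≤ {k} {j} j≤k with k ℕ.<ᵇ j in eq
  ... | false = refl
  ... | true = contradiction (ℕₚ.<ᵇ⇒< k j (subst T (sym eq) tt)) (ℕₚ.≤⇒≯ j≤k)

  generator : ℕ → Vec ℤ n
  generator k = restrict n (shiftSeq k ∘ suc)

  -- The common level of all n + 1 ray generators, which is why a power of a single factor 1 -
  -- x^{s_n} suffices.
  height : ℤ
  height = σ (suc n)

  gap-generator : ∀ {k j} → k ≤ n → j ≤ n →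
                  gap (coord (generator k) height) j ≡ gap (shiftSeq k) j
  gap-generator {k} {j} k≤n j≤n = gap-cong (coord (generator k) height) (shiftSeq k) j (coords (ℕₚ.m≤n⇒m≤1+n j≤n)) (coords (s≤s j≤n))
    where
    coords : ∀ {i} → i ≤ suc n → coord (generator k) height i ≡ shiftSeq k i
    coords {i} i≤1+n = trans
      (cong (λ h → coord (generator k) h i) (sym (shiftSeq-> {k} (s≤s k≤n))))
      (coord-restrict n {shiftSeq k} (shiftSeq-≤ {k} z≤n) i≤1+n)

  gap-generator-≡ : ∀ {k} → k ≤ n → gap (coord (generator k) height) k ≡ modulus k
  gap-generator-≡ {k} k≤n = trans (gap-generator k≤n k≤n)
    (trans (cong₂ (λ a b → b * σ k - a * σ (suc k)) (shiftSeq-≤ {k} ℕₚ.≤-refl) (shiftSeq-> (ℕₚ.n<1+n k)))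
           (simplify (σ k) (σ (suc k))))
    where
    simplify : ∀ a b → b * a - + 0 * b ≡ a * b
    simplify = solve-∀

  -- The ratios of generator k jump from 0 to 1 between positions k and k + 1 and are constant on
  -- either side.
  gap-generator-≢ : ∀ {k j} → k ≤ n → j ≤ n → k ≢ j → gap (coord (generator k) height) j ≡ + 0
  gap-generator-≢ {k} {j} k≤n j≤n k≢j with ℕₚ.<-cmp k j
  ... | tri< k<j _ _ = trans (gap-generator k≤n j≤n)
    (trans (cong₂ (λ a b → b * σ j - a * σ (suc j)) (shiftSeq-> k<j) (shiftSeq-> (ℕₚ.m<n⇒m<1+n k<j)))
           (simplify (σ j) (σ (suc j))))
    where
    simplify : ∀ a b → b * a - a * b ≡ + 0
    simplify = solve-∀
  ... | tri≈ _ k≡j _ = contradiction k≡j k≢j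
  ... | tri> _ _ j<k = trans (gap-generator k≤n j≤n)
    (cong₂ (λ a b → b * σ j - a * σ (suc j)) (shiftSeq-≤ {k} (ℕₚ.<⇒≤ j<k)) (shiftSeq-≤ {k} j<k))

  -- Confining one more gap to a period

  module _ (e : ℤ) {j : ℕ} (j≤n : j ≤ n) where

    private
      g = generator j

      InPeriod : ℤ → Vec ℤ n → Set
      InPeriod t v = gap (coord v t) j ℤ.< e + modulus j

    slab-suc : ∀ t v → (Slab e j t v × InPeriod t v) ⇔ Slab e (suc j) t v
    slab-suc t v = mk⇔ forth back
      where
      forth : Slab e j t v × InPeriod t v → Slab e (suc j) t v
      forth (S , P) k k≤n = proj₁ (S _ k≤n) , upper
        where
        upper : k < suc j → gap (coord v t) k ℤ.< e + modulus k
        upper k<1+j with ℕₚ.m≤n⇒m<n∨m≡n (ℕₚ.m<1+n⇒m≤n k<1+j)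
        ... | inj₁ k<j = proj₂ (S _ k≤n) k<j
        ... | inj₂ refl = P
      back : Slab e (suc j) t v → Slab e j t v × InPeriod t v
      back S = (λ k k≤n → proj₁ (S _ k≤n) , proj₂ (S _ k≤n) ∘ ℕₚ.m<n⇒m<1+n) , proj₂ (S _ (s≤s j≤n)) ℕₚ.≤-refl

    -- Subtracting generator j lowers gap j by one period and keeps the others, so the lower bound e
    -- on gap j survives exactly when gap j was at least one period above e.
    slab-translate : ∀ t v → (∃[ u ] Slab e j (t - height) u × v ≡ zipWith _+_ u g)
                             ⇔ (Slab e j t v × ¬ InPeriod t v)
    slab-translate t v = mk⇔ forth back
      where
      forth : (∃[ u ] Slab e j (t - height) u × v ≡ zipWith _+_ u g) → Slab e j t v × ¬ InPeriod t v
      forth (u , S , refl) = S′ , λ P → ℤₚ.<⇒≱ P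
        (subst (e + modulus j ℤ.≤_)
          (sym (trans (gap-sum j) (cong (λ c → gap (coord u (t - height)) j + c) (gap-generator-≡ j≤n))))
          (ℤₚ.+-monoˡ-≤ (modulus j) (proj₁ (S _ (s≤s j≤n)))))
        where
        gap-sum : ∀ k → gap (coord (zipWith _+_ u g) t) k
                      ≡ gap (coord u (t - height)) k + gap (coord g height) k
        gap-sum k = trans
          (cong (λ t′ → gap (coord (zipWith _+_ u g) t′) k) (sym (minus-cancelʳ-+ t height)))
          (gap-+ u g (t - height) height k)
        S′ : Slab e j t (zipWith _+_ u g)
        S′ k k≤n with j ℕ.≟ k
        ... | yes refl =
          subst (e ℤ.≤_) (sym (trans (gap-sum k) (cong (λ c → gap (coord u (t - height)) k + c) (gap-generator-≡ j≤n))))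
            (ℤₚ.≤-trans (proj₁ (S _ k≤n)) (ℤₚ.i≤i+j _ (modulus k) {{ℤ.nonNegative 0≤modulus}})) ,
          -- At stage j only the gaps before j carry an upper bound.
          λ k<k → contradiction k<k (ℕₚ.<-irrefl refl)
          where
          0≤modulus : + 0 ℤ.≤ modulus k
          0≤modulus = ℤₚ.*-monoʳ-≤-nonNeg (σ (suc k)) {{ℤ.nonNegative (ℤₚ.<⇒≤ (0<σ (suc k)))}} (ℤₚ.<⇒≤ (0<σ k))
        ... | no j≢k = subst (λ c → e ℤ.≤ c × (k < j → c ℤ.< e + modulus k)) (sym unchanged) (S _ k≤n)
          where
          unchanged : gap (coord (zipWith _+_ u g) t) k ≡ gap (coord u (t - height)) k
          unchanged = trans (gap-sum k)
            (trans (cong (λ c → gap (coord u (t - height)) k + c) (gap-generator-≢ j≤n (ℕₚ.m<1+n⇒m≤n k≤n) j≢k)) (ℤₚ.+-identityʳ _))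
      back : Slab e j t v × ¬ InPeriod t v → ∃[ u ] Slab e j (t - height) u × v ≡ zipWith _+_ u g
      back (S , ¬P) = zipWith _-_ v g , S′ , sym (zipWith-cancel _-_ _+_ minus-cancelʳ-+ v g)
        where
        S′ : Slab e j (t - height) (zipWith _-_ v g)
        S′ k k≤n with j ℕ.≟ k
        ... | yes refl =
          subst (e ℤ.≤_) (sym (trans (gap-minus v g t height k) (cong (λ c → gap (coord v t) k - c) (gap-generator-≡ j≤n))))
            (≤-transport (shuffle (gap (coord v t) k) e (modulus k)) (ℤₚ.≮⇒≥ ¬P)) ,
          λ k<k → contradiction k<k (ℕₚ.<-irrefl refl)
          where
          shuffle : ∀ g e m → g - (e + m) ≡ g - m - e
          shuffle = solve-∀
        ... | no j≢k = subst (λ c → e ℤ.≤ c × (k < j → c ℤ.< e + modulus k)) (sym unchanged) (S _ k≤n)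
          where
          unchanged : gap (coord (zipWith _-_ v g) (t - height)) k ≡ gap (coord v t) k
          unchanged = trans (gap-minus v g t height k)
            (trans (cong (λ c → gap (coord v t) k - c) (gap-generator-≢ j≤n (ℕₚ.m<1+n⇒m≤n k≤n) j≢k)) (ℤₚ.+-identityʳ _))

    card-slab-suc : ∀ {f : ℤ → ℤ} → (∀ t → HasCard (Slab e j t) (f t)) →
                    ∀ t → HasCard (Slab e (suc j) t) (Δ height f t)
    card-slab-suc card t = card-resp (slab-suc t)
      (card-split (λ v → gap (coord v t) j ℤ.<? e + modulus j) (card t)
        (card-map (λ u → zipWith _+_ u g) (zipWith-+-injectiveˡ g) (card (t - height)) (slab-translate t)))

  -- Each confined gap contributes one factor 1 - x^{s_n}; at j = n + 1 the parallelepiped is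
  -- counted.
  card-slab : ∀ e {f : ℤ → ℤ} → (∀ t → HasCard (Slab e 0 t) (f t)) →
              ∀ {j} → j ≤ suc n → ∀ t → HasCard (Slab e j t) (Δ^ height j f t)
  card-slab e card {zero} _ = card
  card-slab e card {suc j} (s≤s j≤n) =
    card-slab-suc e j≤n (card-slab e card (ℕₚ.m≤n⇒m≤1+n j≤n))

  -- apex is the sum of the ray generators, so v ↦ apex - v exchanges the two parallelepipeds.

  apexSeq : ℕ → ℤ
  apexSeq j = + j * σ j

  apex : Vec ℤ n
  apex = restrict n (apexSeq ∘ suc)

  apexHeight : ℤ
  apexHeight = apexSeq (suc n)

  -- The ratios of the apex are 0, 1, 2, ..., so every gap is one full period.
  gap-apex : ∀ {k} → k ≤ n → gap (coord apex apexHeight) k ≡ modulus k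
  gap-apex {k} k≤n = trans
    (gap-cong (coord apex apexHeight) apexSeq k (coord-restrict n {apexSeq} (ℤₚ.*-zeroˡ (σ 0)) (ℕₚ.m≤n⇒m≤1+n k≤n)) (coord-restrict n {apexSeq} (ℤₚ.*-zeroˡ (σ 0)) (s≤s k≤n)))
    (simplify (+ k) (σ k) (σ (suc k)))
    where
    simplify : ∀ k a b → (+ 1 + k) * b * a - k * a * b ≡ a * b
    simplify = solve-∀

  -- The reflection sends a gap g to M - g, where M is the modulus. For integers, e ≤ g < e + M is
  -- the same as 1 - e ≤ M - g < 1 - e + M, so one lemma serves both directions.
  slab-reflect : ∀ e t v → Slab e (suc n) t v →
                 Slab (+ 1 - e) (suc n) (apexHeight - t) (zipWith _-_ apex v)
  slab-reflect e t v S k k≤n =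
    subst (λ c → + 1 - e ℤ.≤ c × (k < suc n → c ℤ.< + 1 - e + modulus k)) (sym reflected)
      (≤-transport (shuffle₁ g e M) (ℤₚ.i<j⇒suc[i]≤j (proj₂ (S _ k≤n) k≤n)) ,
       λ _ → ℤₚ.suc[i]≤j⇒i<j (≤-transport (shuffle₂ g e M) (proj₁ (S _ k≤n))))
    where
    g = gap (coord v t) k
    M = modulus k
    reflected : gap (coord (zipWith _-_ apex v) (apexHeight - t)) k ≡ M - g
    reflected = trans (gap-minus apex v apexHeight t k) (cong (_- g) (gap-apex (ℕₚ.m<1+n⇒m≤n k≤n)))
    shuffle₁ : ∀ g e M → e + M - (+ 1 + g) ≡ M - g - (+ 1 - e)
    shuffle₁ = solve-∀
    shuffle₂ : ∀ g e M → g - e ≡ + 1 - e + M - (+ 1 + (M - g))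
    shuffle₂ = solve-∀

  slab-reciprocity : ∀ t v → (∃[ u ] Slab (+ 0) (suc n) (apexHeight - t) u × v ≡ zipWith _-_ apex u)
                             ⇔ Slab (+ 1) (suc n) t v
  slab-reciprocity t v = mk⇔ forth
    (λ S → zipWith _-_ apex v , slab-reflect (+ 1) t v S , sym (zipWith-minus-involutive apex v))
    where
    forth : (∃[ u ] Slab (+ 0) (suc n) (apexHeight - t) u × v ≡ zipWith _-_ apex u) → Slab (+ 1) (suc n) t v
    forth (u , S , refl) = subst (λ t′ → Slab (+ 1) (suc n) t′ (zipWith _-_ apex u))
      (minus-involutive apexHeight t) (slab-reflect (+ 0) (apexHeight - t) u S)

  -- Both sides count the interior parallelepiped at level t, once directly and once through the
  -- reflection.
  Δ^-reciprocity : ∀ {f f° : ℤ → ℤ} → (∀ t → HasCard (Slab (+ 0) 0 t) (f t)) →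
                   (∀ t → HasCard (Slab (+ 1) 0 t) (f° t)) →
                   ∀ t → Δ^ height (suc n) f° t ≡ Δ^ height (suc n) f (apexHeight - t)
  Δ^-reciprocity card card° t = card-unique
    (card-slab (+ 1) card° ℕₚ.≤-refl t)
    (card-map (zipWith _-_ apex)
      (leftInverse⇒injective (zipWith _-_ apex) (zipWith-minus-involutive apex))
      (card-slab (+ 0) card ℕₚ.≤-refl (apexHeight - t)) (slab-reciprocity t))

-- Lecture hall cones

-- Used with (R , e) = (≤ , 0) for the cone and (< , 1) for its interior.
module Facets (R : ℤ → ℤ → Set) (e : ℤ)
              (R⇔ : ∀ {a b} → R a b ⇔ (e ℤ.≤ b - a))
              (R-scale : ∀ {a b} c → + 0 ℤ.< c → R a b ⇔ R (a * c) (b * c))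
              (s : ℕ → ℕ) (σ : ℕ → ℤ) (0<σ : ∀ k → + 0 ℤ.< σ k) (p : ℕ)
              (σ₀ : σ 0 ≡ + 1) (σ≤ : ∀ {k} → k ≤ p → σ (suc k) ≡ + s k)
              (σ-top : σ (suc (suc p)) ≡ + s p) where

  open Cone σ 0<σ (suc p)

  InFacets : Vec ℤ (suc p) → Set
  InFacets v =
    (∀ (i : Fin (suc p)) → toℕ i ≡ 0 → R (+ 0) (lookup v i))
    × (∀ (i j : Fin (suc p)) → toℕ j ≡ suc (toℕ i) →
         R (lookup v i * + s (toℕ j)) (lookup v j * + s (toℕ i)))

  Below : ℤ → Vec ℤ (suc p) → Set
  Below t v = ∀ (i : Fin (suc p)) → toℕ i ≡ p → R (lookup v i) t

  module _ (t : ℤ) (v : Vec ℤ (suc p)) where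

    private
      coord-at : ∀ {i : Fin (suc p)} {k} → toℕ i ≡ k → coord v t (suc k) ≡ lookup v i
      coord-at {i} refl = after-lookup v t i

      σ-at : ∀ {i : Fin (suc p)} {k} → toℕ i ≡ k → σ (suc k) ≡ + s (toℕ i)
      σ-at {i} refl = σ≤ (Finₚ.toℕ≤pred[n] i)

      σ-last : σ (suc p) ≡ σ (suc (suc p))
      σ-last = trans (σ≤ ℕₚ.≤-refl) (sym σ-top)

      chain-first : R (coord v t 0 * σ 1) (coord v t 1 * σ 0) ≡ R (+ 0) (lookup v Fin.zero)
      chain-first = cong₂ R (ℤₚ.*-zeroˡ (σ 1))
        (trans (cong₂ _*_ (after-lookup v t Fin.zero) σ₀) (ℤₚ.*-identityʳ _))

      chain-middle : ∀ {i j k} → toℕ i ≡ k → toℕ j ≡ suc k →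
        R (coord v t (suc k) * σ (suc (suc k))) (coord v t (suc (suc k)) * σ (suc k))
          ≡ R (lookup v i * + s (toℕ j)) (lookup v j * + s (toℕ i))
      chain-middle i≡ j≡ = cong₂ R (cong₂ _*_ (coord-at i≡) (σ-at j≡)) (cong₂ _*_ (coord-at j≡) (σ-at i≡))

      -- The last two weights agree, so both sides carry the same positive factor; `R-scale` then
      -- cancels it and leaves a comparison of λ_n with t.
      chain-last : ∀ {i} → toℕ i ≡ p →
        R (coord v t (suc p) * σ (suc (suc p))) (coord v t (suc (suc p)) * σ (suc p))
          ≡ R (lookup v i * σ (suc (suc p))) (t * σ (suc (suc p)))
      chain-last i≡ = cong₂ R (cong (_* σ (suc (suc p))) (coord-at i≡)) (cong₂ _*_ (after-last v t) σ-last)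

    facets⇒slab : InFacets v → Below t v → Slab e 0 t v
    facets⇒slab (first , middle) last k k≤n = to R⇔ (chain k k≤n) , λ ()
      where
      chain : ∀ k → k < suc (suc p) → R (coord v t k * σ (suc k)) (coord v t (suc k) * σ k)
      chain zero _ = subst id (sym chain-first) (first Fin.zero refl)
      chain (suc k) (s≤s k<1+p) with ℕₚ.m≤n⇒m<n∨m≡n (ℕₚ.m<1+n⇒m≤n k<1+p)
      ... | inj₁ k<p = subst id (sym (chain-middle i≡ j≡)) (middle i j (trans j≡ (cong suc (sym i≡))))
        where
        i = fromℕ< k<1+p
        j = fromℕ< (s≤s k<p)
        i≡ = Finₚ.toℕ-fromℕ< k<1+p
        j≡ = Finₚ.toℕ-fromℕ< (s≤s k<p)
      ... | inj₂ refl = subst id (sym (chain-last i≡)) (to (R-scale _ (0<σ (suc (suc p)))) (last i i≡))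
        where
        i = fromℕ< k<1+p
        i≡ = Finₚ.toℕ-fromℕ< k<1+p

    slab⇒facets : Slab e 0 t v → InFacets v × Below t v
    slab⇒facets S = (first , middle) , last
      where
      chain : ∀ {k} → k < suc (suc p) → R (coord v t k * σ (suc k)) (coord v t (suc k) * σ k)
      chain k≤n = from R⇔ (proj₁ (S _ k≤n))
      first : ∀ i → toℕ i ≡ 0 → R (+ 0) (lookup v i)
      first Fin.zero _ = subst id chain-first (chain (s≤s z≤n))
      middle : ∀ i j → toℕ j ≡ suc (toℕ i) → R (lookup v i * + s (toℕ j)) (lookup v j * + s (toℕ i))
      middle i j j≡ = subst id (chain-middle refl j≡) (chain (ℕₚ.m<n⇒m<1+n (subst (_< suc p) j≡ (Finₚ.toℕ<n j))))
      last : Below t v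
      last i i≡ = from (R-scale _ (0<σ (suc (suc p)))) (subst id (chain-last i≡) (chain ℕₚ.≤-refl))

    slab⇔facets : (InFacets v × Below t v) ⇔ Slab e 0 t v
    slab⇔facets = mk⇔ (λ (F , B) → facets⇒slab F B) slab⇒facets

≤-difference : ∀ {a b} → (a ℤ.≤ b) ⇔ (+ 0 ℤ.≤ b - a)
≤-difference = mk⇔ ℤₚ.i≤j⇒0≤j-i ℤₚ.0≤i-j⇒j≤i

<-difference : ∀ {a b} → (a ℤ.< b) ⇔ (+ 1 ℤ.≤ b - a)
<-difference {a} {b} = mk⇔
  (λ a<b → ≤-transport (shuffle a b) (ℤₚ.i<j⇒suc[i]≤j a<b))
  (λ 1≤ → ℤₚ.suc[i]≤j⇒i<j (≤-transport (sym (shuffle a b)) 1≤))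
  where
  shuffle : ∀ a b → b - (+ 1 + a) ≡ b - a - + 1
  shuffle = solve-∀

≤-scale : ∀ {a b} c → + 0 ℤ.< c → (a ℤ.≤ b) ⇔ (a * c ℤ.≤ b * c)
≤-scale {a} {b} c 0<c = mk⇔
  (ℤₚ.*-monoʳ-≤-nonNeg c {{ℤ.nonNegative (ℤₚ.<⇒≤ 0<c)}})
  (ℤₚ.*-cancelʳ-≤-pos a b c {{ℤ.positive 0<c}})

<-scale : ∀ {a b} c → + 0 ℤ.< c → (a ℤ.< b) ⇔ (a * c ℤ.< b * c)
<-scale c 0<c = mk⇔
  (ℤₚ.*-monoʳ-<-pos c {{ℤ.positive 0<c}})
  (ℤₚ.*-cancelʳ-<-nonNeg c {{ℤ.nonNegative (ℤₚ.<⇒≤ 0<c)}})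

module LectureHall (s : ℕ → ℕ) (0<s : ∀ k → 0 < s k) (p : ℕ) where

  n = suc p

  -- The weights 1, s_1, ..., s_n, s_n, .... The leading 1 turns the first gap condition into the
  -- one on the sign of λ_1, and the repeated s_n turns the last into the one comparing λ_n with t.
  σ : ℕ → ℤ
  σ zero = + 1
  σ (suc j) = + s (j ⊓ p)

  0<σ : ∀ k → + 0 ℤ.< σ k
  0<σ zero = ℤ.+<+ (s≤s z≤n)
  0<σ (suc j) = ℤ.+<+ (0<s (j ⊓ p))

  σ-top : σ (suc n) ≡ + s p
  σ-top = cong (λ j → + s j) (ℕₚ.m≥n⇒m⊓n≡n (ℕₚ.n≤1+n p))

  open Cone σ 0<σ n public

  private
    σ≤ : ∀ {k} → k ≤ p → σ (suc k) ≡ + s k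
    σ≤ k≤p = cong (λ j → + s j) (ℕₚ.m≤n⇒m⊓n≡m k≤p)

  module Closed = Facets ℤ._≤_ (+ 0) ≤-difference ≤-scale s σ 0<σ p refl σ≤ σ-top
  module Open = Facets ℤ._<_ (+ 1) <-difference <-scale s σ 0<σ p refl σ≤ σ-top

  last : Vec ℤ n → ℤ
  last v = lookup v (Fin.fromℕ p)

  at-last : ∀ (P : ℤ → Set) v → P (last v) → ∀ (i : Fin n) → toℕ i ≡ p → P (lookup v i)
  at-last P v Pv i i≡p =
    subst (λ j → P (lookup v j)) (Finₚ.toℕ-injective (trans (Finₚ.toℕ-fromℕ p) (sym i≡p))) Pv

  cone⇒slab : ∀ {v t} → InCone s n v → last v ℤ.≤ t → Slab (+ 0) 0 t v
  cone⇒slab {v} {t} F v≤t = Closed.facets⇒slab t v F (at-last (ℤ._≤ t) v v≤t)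

  interior⇒slab : ∀ {v t} → InInterior s n v → last v ℤ.< t → Slab (+ 1) 0 t v
  interior⇒slab {v} {t} F v<t = Open.facets⇒slab t v F (at-last (ℤ._< t) v v<t)

  slab⇒cone : ∀ {v t} → Slab (+ 0) 0 t v → InCone s n v × last v ℤ.≤ t
  slab⇒cone {v} {t} S = let (F , B) = Closed.slab⇒facets t v S in F , B (Fin.fromℕ p) (Finₚ.toℕ-fromℕ p)

  slab⇒interior : ∀ {v t} → Slab (+ 1) 0 t v → InInterior s n v × last v ℤ.< t
  slab⇒interior {v} {t} S = let (F , B) = Open.slab⇒facets t v S in F , B (Fin.fromℕ p) (Finₚ.toℕ-fromℕ p)

  -- Counting functions of the cone and of its interior

  module _ (i : ℕ → ℕ) (dilates : ∀ t → IsCardinality (InDilate s n t) (i t)) where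

    I : ℤ → ℤ
    I = atℕ i

    card : ∀ t → HasCard (Slab (+ 0) 0 t) (I t)
    card (+ t) = let (xs , unique , mem , len) = dilates t in
      card-resp (Closed.slab⇔facets (+ t)) (xs , unique , mem , cong +_ len)
    card -[1+ t ] = card-empty {P = Slab (+ 0) 0 -[1+ t ]} λ v S → contradiction (slab-level-nonneg {v = v} S) λ ()

    -- Interior points at level t, those with λ_n < t, are found among the finitely many listed cone
    -- points at level t.
    I° : ℤ → ℤ
    I° t = + length (filter (slab? (+ 1) 0 t) (proj₁ (card t)))

    card° : ∀ t → HasCard (Slab (+ 1) 0 t) (I° t)
    card° t = card-resp
      (λ v → mk⇔ proj₂ λ S → slab-weaken {v = v} (ℤ.+≤+ z≤n) S , S)
      (card-filter (slab? (+ 1) 0 t) (card t))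

    I-negative : ∀ {t} → t ℤ.≤ -[1+ 0 ] → I t ≡ + 0
    I-negative { -[1+ t ]} _ = refl

    I°-nonpositive : ∀ {t} → t ℤ.≤ + 0 → I° t ≡ + 0
    I°-nonpositive {t} t≤0 =
      card-unique (card° t) (card-empty {P = Slab (+ 1) 0 t} λ v S → ℤₚ.≤⇒≯ t≤0 (slab-level-pos {v = v} S))

    I0≢0 : I (+ 0) ≢ + 0
    I0≢0 = card-≢0 (card (+ 0)) (restrict n (λ _ → + 0) , slab-origin)

    Q Q° : ℤ → ℤ
    Q = Δ^ height (suc n) I
    Q° = Δ^ height (suc n) I°

    hstar≡Q : ∀ k → hstarCoeff s n i k ≡ Q (+ k)
    hstar≡Q k = trans (hstarCoeff≡Δ^ s n i k) (cong (λ h → Δ^ h (suc n) I (+ k)) (sym σ-top))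

    N : ℤ
    N = apexHeight

    Q°≡Q : ∀ t → Q° t ≡ Q (N - t)
    Q°≡Q = Δ^-reciprocity card card°

    Q-negative : ∀ {t} → t ℤ.≤ -[1+ 0 ] → Q t ≡ + 0
    Q-negative = Δ^-vanish height (0<σ (suc n)) (suc n) _ I-negative

    -- By reciprocity Q(t) is the value of `Q°` at N - t ≤ 0, and the interior has no points at such
    -- levels.
    Q-high : ∀ {t} → N ℤ.≤ t → Q t ≡ + 0
    Q-high {t} N≤t = trans (cong Q (sym (minus-involutive N t)))
      (trans (sym (Q°≡Q (N - t)))
        (Δ^-vanish height (0<σ (suc n)) (suc n) _ I°-nonpositive (ℤₚ.i≤j⇒i-j≤0 N≤t)))

    -- Each difference at 0 subtracts a value at a negative argument, which is zero.
    Q0≡I0 : Q (+ 0) ≡ I (+ 0)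
    Q0≡I0 = lowest (suc n)
      where
      lowest : ∀ m → Δ^ height m I (+ 0) ≡ I (+ 0)
      lowest zero = refl
      lowest (suc m) = trans
        (cong₂ _-_ (lowest m) (Δ^-vanish height (0<σ (suc n)) m _ I-negative 0-height≤-1))
        (ℤₚ.+-identityʳ _)
        where
        0-height≤-1 : + 0 - height ℤ.≤ -[1+ 0 ]
        0-height≤-1 = ≤-transport (shuffle height) (ℤₚ.i<j⇒suc[i]≤j (0<σ (suc n)))
          where
          shuffle : ∀ h → h - + 1 ≡ -[1+ 0 ] - (+ 0 - h)
          shuffle = solve-∀

    slab-+° : ∀ {c u t t′} → Slab (+ 1) 0 t c → Slab (+ 0) 0 t′ u → Slab (+ 1) 0 (t + t′) (zipWith _+_ c u)
    slab-+° {c} {u} {t} {t′} = slab-+ {t = t} {t′} {c} {u}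

    -- Symmetry implies Gorenstein

    module _ (sym-coeffs : SymmetricCoeffs (hstarCoeff s n i)) where

      private
        d = proj₁ sym-coeffs
        m = N - + d

      Q-above : ∀ {k} → d < k → Q (+ k) ≡ + 0
      Q-above d<k = trans (sym (hstar≡Q _)) (proj₁ (proj₂ (proj₂ sym-coeffs)) _ d<k)

      -- Q is nonzero at d but zero from N on. Hence m is positive, and `I` shifted by m still
      -- vanishes at negative levels.
      d<N : + d ℤ.< N
      d<N = ℤₚ.≰⇒> λ N≤d → proj₁ (proj₂ sym-coeffs) (trans (hstar≡Q d) (Q-high N≤d))

      -- Outside the range from 0 to d both sides are zero. All integers are needed, because the
      -- reciprocity argument N - t ranges over them.
      Q-palindrome : ∀ u → Q u ≡ Q (+ d - u)
      Q-palindrome -[1+ k ] = trans (Q-negative (ℤ.-≤- z≤n)) (sym (Q-above (ℕₚ.m<m+n d (s≤s z≤n))))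
      Q-palindrome (+ k) with k ℕ.≤? d
      ... | yes k≤d = trans (sym (hstar≡Q k)) (trans (proj₂ (proj₂ (proj₂ sym-coeffs)) k k≤d)
        (trans (hstar≡Q (d ∸ k)) (cong Q (sym (trans (ℤₚ.m-n≡m⊖n d k) (ℤₚ.⊖-≥ k≤d))))))
      ... | no k≰d = trans (Q-above (ℕₚ.≰⇒> k≰d)) (sym (Q-negative
        (≤-transport (shuffle (+ k) (+ d)) (ℤ.+≤+ (ℕₚ.≰⇒> k≰d)))))
        where
        shuffle : ∀ k d → k - (+ 1 + d) ≡ -[1+ 0 ] - (d - k)
        shuffle = solve-∀

      I°≡I : ∀ t → I° t ≡ I (t - m)
      I°≡I = Δ^-injective height (0<σ (suc n)) (suc n)
        (λ t≤-1 → I°-nonpositive (ℤₚ.≤-trans t≤-1 ℤ.-≤+))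
        (λ {t} t≤-1 → I-negative (ℤₚ.≤-trans
          (ℤₚ.i-j≤i t m {{ℤ.nonNegative (ℤₚ.i≤j⇒0≤j-i (ℤₚ.<⇒≤ d<N))}}) t≤-1))
        λ t → trans (Q°≡Q t) (trans (Q-palindrome (N - t))
          (trans (cong Q (shuffle (+ d) N t)) (sym (Δ^-translate height (suc n) m (λ _ → refl) t))))
        where
        shuffle : ∀ d N t → d - (N - t) ≡ t - (N - d)
        shuffle = solve-∀

      symmetric⇒gorenstein : Gorenstein s n
      symmetric⇒gorenstein = c , proj₁ (slab⇒interior {c} c∈) , λ v → mk⇔ (interior⇒translate v) (translate⇒interior v)
        where
        interior-point : ∃ (Slab (+ 1) 0 m)
        -- At level m the identity `I°≡I` gives the value of `I` at 0, which is nonzero because of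
        -- the origin.
        interior-point = card-inhabited (card° m) λ I°m≡0 → I0≢0
          (trans (cong I (sym (ℤₚ.+-inverseʳ m))) (trans (sym (I°≡I m)) I°m≡0))
        c = proj₁ interior-point
        c∈ : Slab (+ 1) 0 m c
        c∈ = proj₂ interior-point
        Translate : ℤ → Vec ℤ n → Set
        Translate t v = ∃[ u ] Slab (+ 0) 0 (t - m) u × v ≡ zipWith _+_ c u
        translate⊆ : ∀ t v → Translate t v → Slab (+ 1) 0 t v
        translate⊆ t v (u , S , refl) = subst (λ t′ → Slab (+ 1) 0 t′ v) (shuffle m t) (slab-+° {c} {u} c∈ S)
          where
          shuffle : ∀ m t → m + (t - m) ≡ t
          shuffle = solve-∀
        card-translate : ∀ t → HasCard (Translate t) (I° t)
        card-translate t = subst (HasCard (Translate t)) (sym (I°≡I t))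
          (card-map (zipWith _+_ c) (zipWith-+-injectiveʳ c) (card (t - m)) λ v → mk⇔ id id)
        interior⇒translate : ∀ v → InInterior s n v → Σ (Vec ℤ n) λ μ → InCone s n μ × v ≡ zipWith _+_ c μ
        interior⇒translate v v∈ =
          -- The least level at which `v` counts as interior, since λ_n < t is strict.
          let t = + 1 + last v
              (u , S , v≡) = card-⊆-equal (Vecₚ.≡-dec ℤ._≟_) (translate⊆ t) (card-translate t) (card° t) v
                               (interior⇒slab {v} v∈ (ℤₚ.suc[i]≤j⇒i<j ℤₚ.≤-refl))
          in u , proj₁ (slab⇒cone {u} S) , v≡
        translate⇒interior : ∀ v → (Σ (Vec ℤ n) λ μ → InCone s n μ × v ≡ zipWith _+_ c μ) → InInterior s n v
        translate⇒interior v (u , u∈ , refl) =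
          proj₁ (slab⇒interior {v} (slab-+° {c} {u} c∈ (cone⇒slab {u} u∈ ℤₚ.≤-refl)))

    -- Gorenstein implies symmetry

    module _ (gorenstein : Gorenstein s n) where

      private
        c = proj₁ gorenstein
        m = + 1 + last c
        c∈ : Slab (+ 1) 0 m c
        c∈ = interior⇒slab {c} (proj₁ (proj₂ gorenstein)) (ℤₚ.suc[i]≤j⇒i<j ℤₚ.≤-refl)

      -- The 1 in m absorbs the strictness: c_n + u_n < t is the same as u_n ≤ t - m.
      translate⇔ : ∀ t v → (∃[ u ] Slab (+ 0) 0 (t - m) u × v ≡ zipWith _+_ c u) ⇔ Slab (+ 1) 0 t v
      translate⇔ t v = mk⇔ forth back
        where
        forth : (∃[ u ] Slab (+ 0) 0 (t - m) u × v ≡ zipWith _+_ c u) → Slab (+ 1) 0 t v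
        forth (u , S , refl) = subst (λ t′ → Slab (+ 1) 0 t′ v) (shuffle m t) (slab-+° {c} {u} c∈ S)
          where
          shuffle : ∀ m t → m + (t - m) ≡ t
          shuffle = solve-∀
        back : Slab (+ 1) 0 t v → ∃[ u ] Slab (+ 0) 0 (t - m) u × v ≡ zipWith _+_ c u
        back S with slab⇒interior {v} S
        ... | v∈ , v<t with to (proj₂ (proj₂ gorenstein) v) v∈
        ... | u , u∈ , refl = u , cone⇒slab {u} u∈ (≤-transport (shuffle t (last c) (last u))
              (ℤₚ.i<j⇒suc[i]≤j (subst (ℤ._< t) (Vecₚ.lookup-zipWith _+_ (Fin.fromℕ p) c u) v<t))) , refl
          where
          shuffle : ∀ t c u → t - (+ 1 + (c + u)) ≡ t - (+ 1 + c) - u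
          shuffle = solve-∀

      Q-reflect : ∀ t → Q (N - t) ≡ Q (t - m)
      Q-reflect t = trans (sym (Q°≡Q t)) (Δ^-translate height (suc n) m
        (λ t → card-unique (card° t)
          (card-map (zipWith _+_ c) (zipWith-+-injectiveʳ c) (card (t - m)) (translate⇔ t))) t)

      -- `Q-reflect` at t = m identifies this value with Q(0), the nonzero number of cone points at
      -- level 0.
      Q-top : Q (N - m) ≢ + 0
      Q-top eq = I0≢0 (trans (sym Q0≡I0) (trans (cong Q (sym (ℤₚ.+-inverseʳ m))) (trans (sym (Q-reflect m)) eq)))

      -- Q vanishes at negative arguments, so `Q-top` forces N - m to be nonnegative.
      degree : ∃[ d ] + d ≡ N - m
      degree with N - m in eq
      ... | + d = d , refl
      ... | -[1+ _ ] = contradiction (trans (cong Q eq) (Q-negative (ℤ.-≤- z≤n))) Q-top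

      gorenstein⇒symmetric : SymmetricCoeffs (hstarCoeff s n i)
      gorenstein⇒symmetric = d
        , (λ q≡0 → Q-top (trans (cong Q (sym d≡)) (trans (sym (hstar≡Q d)) q≡0)))
        -- Beyond d the palindrome leads to the negative argument d - k.
        , (λ k d<k → trans (hstar≡Q k) (trans (palindrome (+ k))
            (Q-negative (≤-transport (shuffle (+ k) (+ d)) (ℤ.+≤+ d<k)))))
        , (λ k k≤d → trans (hstar≡Q k) (trans (palindrome (+ k))
            (trans (cong Q (trans (ℤₚ.m-n≡m⊖n d k) (ℤₚ.⊖-≥ k≤d))) (sym (hstar≡Q (d ∸ k))))))
        where
        d = proj₁ degree
        d≡ = proj₂ degree
        shuffle : ∀ k d → k - (+ 1 + d) ≡ -[1+ 0 ] - (d - k)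
        shuffle = solve-∀
        palindrome : ∀ u → Q u ≡ Q (+ d - u)
        palindrome u = trans (cong Q (sym (minus-involutive N u)))
          (trans (Q-reflect (N - u)) (cong Q (trans (swap N u m) (cong (_- u) (sym d≡)))))
          where
          swap : ∀ N u m → N - u - m ≡ N - m - u
          swap = solve-∀

theorem4p1 : (s : ℕ → ℕ) → (∀ k → 0 < s k) → (n : ℕ) → 1 ≤ n →
    (i : ℕ → ℕ) → (∀ t → IsCardinality (InDilate s n t) (i t)) →
    (SymmetricCoeffs (hstarCoeff s n i) ⇔ Gorenstein s n)
theorem4p1 s 0<s (suc p) _ i dilates =
  mk⇔ (symmetric⇒gorenstein i dilates) (gorenstein⇒symmetric i dilates)
  where open LectureHall s 0<s p
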